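{- Let $k$ be a positive integer. For all non-negative integers $n,r$ with $n\geq r$, $$M_{n-r}^{(k)}M_{n+r}^{(k)}-\left(M_n^{(k)}\right)^2=-(2^k)^{n-r}\left(M_{r}^{(k)}\right)^2 .$$
   Context: The Mersenne numbers $\{M_n\}_{n\ge 0}$ are defined by $M_0=0$, $M_1=1$, $M_{n+2}=3M_{n+1}-2M_n$, i.e. $M_n=2^n-1$. For a positive integer $k$, the higher order Mersenne numbers are $M_n^{(k)}=M_{kn}/M_k$ for $n=0,1,2,\dots$. -}

module Defs where

open import Data.Nat.Base as ℕ using (ℕ; zero; suc)
open import Data.Integer.Base as ℤ using (ℤ; +_; 0ℤ; 1ℤ)
open import Data.Integer.Tactic.RingSolver using (solve-∀)
open import Data.Rational.Base as ℚ using (ℚ; _÷_)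
import Data.Rational.Properties as ℚₚ
open import Relation.Binary.PropositionalEquality

M : ℕ → ℤ
M zero          = 0ℤ
M (suc zero)    = 1ℤ
M (suc (suc n)) = + 3 ℤ.* M (suc n) ℤ.- + 2 ℤ.* M n

fromℤ : ℤ → ℚ
fromℤ i = i ℚ./ 1

M-closed : ∀ n → M n ≡ (+ 2) ℤ.^ n ℤ.- 1ℤ
M-closed zero          = refl
M-closed (suc zero)    = refl
M-closed (suc (suc n)) = trans
  (cong₂ (λ x y → + 3 ℤ.* x ℤ.- + 2 ℤ.* y) (M-closed (suc n)) (M-closed n))
  (identity ((+ 2) ℤ.^ n))
  where
  identity : ∀ p → + 3 ℤ.* (+ 2 ℤ.* p ℤ.- 1ℤ) ℤ.- + 2 ℤ.* (p ℤ.- 1ℤ)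
                 ≡ + 2 ℤ.* (+ 2 ℤ.* p) ℤ.- 1ℤ
  identity = solve-∀

M-step : ∀ n → M (suc n) ≡ 1ℤ ℤ.+ + 2 ℤ.* M n
M-step n = trans (M-closed (suc n))
  (trans (identity ((+ 2) ℤ.^ n)) (cong (λ x → 1ℤ ℤ.+ + 2 ℤ.* x) (sym (M-closed n))))
  where
  identity : ∀ p → + 2 ℤ.* p ℤ.- 1ℤ ≡ 1ℤ ℤ.+ + 2 ℤ.* (p ℤ.- 1ℤ)
  identity = solve-∀

M-nonNegative : ∀ n → ℤ.NonNegative (M n)
M-positive    : ∀ n → ℤ.Positive (M (suc n))

M-nonNegative zero    = _
M-nonNegative (suc n) = pos⇒nonNeg (M (suc n)) {{M-positive n}}
  where
  pos⇒nonNeg : ∀ i .{{_ : ℤ.Positive i}} → ℤ.NonNegative i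
  pos⇒nonNeg (+ suc m) = _

M-positive n = subst ℤ.Positive (sym (M-step n)) (step (M n) {{M-nonNegative n}})
  where
  step : ∀ i .{{_ : ℤ.NonNegative i}} → ℤ.Positive (1ℤ ℤ.+ + 2 ℤ.* i)
  step (+ zero)  = _
  step (+ suc m) = _

fromℤ-nonZero : ∀ i .{{_ : ℤ.Positive i}} → ℚ.NonZero (fromℤ i)
fromℤ-nonZero (+ suc m) =
  ℚₚ.pos⇒nonZero (fromℤ (+ suc m)) {{ℚₚ.normalize-pos (suc m) 1}}

M-nonZero : ∀ k .{{_ : ℕ.NonZero k}} → ℚ.NonZero (fromℤ (M k))
M-nonZero (suc k) = fromℤ-nonZero (M (suc k)) {{M-positive k}}

-- The quotient is taken in ℚ, so that it is exact without presupposing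
-- that M k divides M (k * n).
M⟨_⟩ : (k : ℕ) .{{_ : ℕ.NonZero k}} → ℕ → ℚ
M⟨ k ⟩ n = (fromℤ (M (k ℕ.* n)) ÷ fromℤ (M k)) {{M-nonZero k}}

{-# OPTIONS --safe #-}

-- With a = 2^{k(n−r)} and b = 2^{kr}, clearing the common denominator M_k²
-- leaves the polynomial identity (a − 1)(ab² − 1) + a (b − 1)² = (ab − 1)².

module Submission where

open import Defs
open import Data.Nat.Base as ℕ using (ℕ; NonZero; _≥_; _∸_)
import Data.Nat.Properties as ℕₚ
open import Data.Integer.Base as ℤ using (ℤ; +_; 1ℤ)
import Data.Integer.Properties as ℤₚ
open import Data.Integer.Tactic.RingSolver using (solve-∀)
open import Data.Rational.Base as ℚ using (ℚ; _+_; _*_; _-_; -_; 1/_; toℚᵘ)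
import Data.Rational.Properties as ℚₚ
open import Data.Rational.Solver using (module +-*-Solver)
open import Data.Rational.Unnormalised.Base as ℚᵘ using (mkℚᵘ; *≡*)
import Data.Rational.Unnormalised.Properties as ℚᵘₚ
open import Relation.Binary.PropositionalEquality
  using (_≡_; refl; sym; trans; cong; cong₂; module ≡-Reasoning)

-- Every higher order Mersenne number here is an integer over the same `M k`, so the claim is a
-- Catalan identity for ordinary Mersenne numbers at the indices `k * (n ∸ r)`, `k * n` and
-- `k * (n + r)`, divided by the square of `M k`. `M-catalan` derives the integer identity from the
-- closed form, `M-catalan-multiples` moves it to these indices, the `fromℤ` homomorphisms carry it
-- into ℚ, and `scale-catalan` puts the denominators back.

toℚᵘ-fromℤ : ∀ i → toℚᵘ (fromℤ i) ℚᵘ.≃ mkℚᵘ i 0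
toℚᵘ-fromℤ i = ℚₚ.toℚᵘ-fromℚᵘ (mkℚᵘ i 0)

-- Comparing in the unnormalised rationals avoids gcd reduction: all denominators are 1 and only a
-- ring identity on numerators is left.
fromℤ-homo-+ : ∀ i j → fromℤ (i ℤ.+ j) ≡ fromℤ i + fromℤ j
fromℤ-homo-+ i j = ℚₚ.toℚᵘ-injective (begin
  toℚᵘ (fromℤ (i ℤ.+ j))                ≈⟨ toℚᵘ-fromℤ (i ℤ.+ j) ⟩
  mkℚᵘ (i ℤ.+ j) 0                      ≈⟨ *≡* (identity i j) ⟩
  mkℚᵘ i 0 ℚᵘ.+ mkℚᵘ j 0                ≈⟨ ℚᵘₚ.+-cong (toℚᵘ-fromℤ i) (toℚᵘ-fromℤ j) ⟨
  toℚᵘ (fromℤ i) ℚᵘ.+ toℚᵘ (fromℤ j)    ≈⟨ ℚₚ.toℚᵘ-homo-+ (fromℤ i) (fromℤ j) ⟨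
  toℚᵘ (fromℤ i + fromℤ j)              ∎)
  where
  open import Relation.Binary.Reasoning.Setoid ℚᵘₚ.≃-setoid
  identity : ∀ i j → (i ℤ.+ j) ℤ.* 1ℤ ≡ (i ℤ.* 1ℤ ℤ.+ j ℤ.* 1ℤ) ℤ.* 1ℤ
  identity = solve-∀

fromℤ-homo-* : ∀ i j → fromℤ (i ℤ.* j) ≡ fromℤ i * fromℤ j
fromℤ-homo-* i j = ℚₚ.toℚᵘ-injective (begin
  toℚᵘ (fromℤ (i ℤ.* j))                ≈⟨ toℚᵘ-fromℤ (i ℤ.* j) ⟩
  mkℚᵘ i 0 ℚᵘ.* mkℚᵘ j 0                ≈⟨ ℚᵘₚ.*-cong (toℚᵘ-fromℤ i) (toℚᵘ-fromℤ j) ⟨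
  toℚᵘ (fromℤ i) ℚᵘ.* toℚᵘ (fromℤ j)    ≈⟨ ℚₚ.toℚᵘ-homo-* (fromℤ i) (fromℤ j) ⟨
  toℚᵘ (fromℤ i * fromℤ j)              ∎)
  where open import Relation.Binary.Reasoning.Setoid ℚᵘₚ.≃-setoid

-- With `d` in the role of `n ∸ r`, no index is subtracted. The closed form and the exponent law
-- make both sides polynomials in `2 ^ d` and `2 ^ r`.
M-catalan : ∀ d r →
  M d ℤ.* M (d ℕ.+ r ℕ.+ r) ℤ.+ (+ 2) ℤ.^ d ℤ.* (M r ℤ.* M r)
    ≡ M (d ℕ.+ r) ℤ.* M (d ℕ.+ r)
M-catalan d r
  rewrite M-closed d | M-closed r | M-closed (d ℕ.+ r) | M-closed (d ℕ.+ r ℕ.+ r)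
        | ℤₚ.^-distribˡ-+-* (+ 2) (d ℕ.+ r) r | ℤₚ.^-distribˡ-+-* (+ 2) d r
  = identity ((+ 2) ℤ.^ d) ((+ 2) ℤ.^ r)
  where
  identity : ∀ a b →
    (a ℤ.- 1ℤ) ℤ.* (a ℤ.* b ℤ.* b ℤ.- 1ℤ) ℤ.+ a ℤ.* ((b ℤ.- 1ℤ) ℤ.* (b ℤ.- 1ℤ))
      ≡ (a ℤ.* b ℤ.- 1ℤ) ℤ.* (a ℤ.* b ℤ.- 1ℤ)
  identity = solve-∀

*-split : ∀ k {n r} → n ≥ r → k ℕ.* n ≡ k ℕ.* (n ∸ r) ℕ.+ k ℕ.* r
*-split k {n} {r} n≥r =
  trans (cong (k ℕ.*_) (sym (ℕₚ.m∸n+n≡m n≥r))) (ℕₚ.*-distribˡ-+ k (n ∸ r) r)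

M-catalan-multiples : ∀ k n r → n ≥ r →
  M (k ℕ.* (n ∸ r)) ℤ.* M (k ℕ.* (n ℕ.+ r))
    ℤ.+ ((+ 2) ℤ.^ k) ℤ.^ (n ∸ r) ℤ.* (M (k ℕ.* r) ℤ.* M (k ℕ.* r))
    ≡ M (k ℕ.* n) ℤ.* M (k ℕ.* n)
M-catalan-multiples k n r n≥r
  -- Splitting `k * (n + r)` exposes a further `k * n`, so the last rewrite yields both index shapes
  -- of `M-catalan`.
  rewrite ℤₚ.^-*-assoc (+ 2) k (n ∸ r)
        | ℕₚ.*-distribˡ-+ k n r
        | *-split k n≥r
  = M-catalan (k ℕ.* (n ∸ r)) (k ℕ.* r)

-- Both sides are homogeneous of degree two in `i`, the common reciprocal, so a relation between
-- numerators is just multiplied by `i * i`.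
scale-catalan : ∀ p q c t s i → p * q + c * (t * t) ≡ s * s →
  (p * i) * (q * i) - (s * i) * (s * i) ≡ - (c * ((t * i) * (t * i)))
scale-catalan p q c t s i eq = begin
  (p * i) * (q * i) - (s * i) * (s * i)
    ≡⟨ expand p q s i ⟩
  (p * q - s * s) * (i * i)
    ≡⟨ cong (λ x → (p * q - x) * (i * i)) eq ⟨
  (p * q - (p * q + c * (t * t))) * (i * i)
    ≡⟨ cancel p q c t i ⟩
  - (c * ((t * i) * (t * i))) ∎
  where
  open ≡-Reasoning
  open +-*-Solver
  expand : ∀ p q s i →
    (p * i) * (q * i) - (s * i) * (s * i) ≡ (p * q - s * s) * (i * i)
  expand = solve 4 (λ p q s i →
    (p :* i) :* (q :* i) :- (s :* i) :* (s :* i) := (p :* q :- s :* s) :* (i :* i)) refl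
  cancel : ∀ p q c t i →
    (p * q - (p * q + c * (t * t))) * (i * i) ≡ - (c * ((t * i) * (t * i)))
  cancel = solve 5 (λ p q c t i →
    (p :* q :- (p :* q :+ c :* (t :* t))) :* (i :* i) := :- (c :* ((t :* i) :* (t :* i)))) refl

theorem2p8 : (k : ℕ) .{{_ : NonZero k}} (n r : ℕ) → n ≥ r →
    M⟨ k ⟩ (n ∸ r) * M⟨ k ⟩ (n ℕ.+ r) - M⟨ k ⟩ n * M⟨ k ⟩ n
    ≡ - (fromℤ (((+ 2) ℤ.^ k) ℤ.^ (n ∸ r)) * (M⟨ k ⟩ r * M⟨ k ⟩ r))
theorem2p8 k n r n≥r =
  -- `x ÷ y` unfolds to `x * 1/ y`, so each quotient already has the form `x * i`.
  scale-catalan (fromℤ P) (fromℤ Q) (fromℤ C) (fromℤ T) (fromℤ S)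
    ((1/ fromℤ (M k)) {{M-nonZero k}}) (begin
      fromℤ P * fromℤ Q + fromℤ C * (fromℤ T * fromℤ T)
        ≡⟨ cong (λ x → fromℤ P * fromℤ Q + fromℤ C * x) (fromℤ-homo-* T T) ⟨
      fromℤ P * fromℤ Q + fromℤ C * fromℤ (T ℤ.* T)
        ≡⟨ cong₂ _+_ (fromℤ-homo-* P Q) (fromℤ-homo-* C (T ℤ.* T)) ⟨
      fromℤ (P ℤ.* Q) + fromℤ (C ℤ.* (T ℤ.* T))
        ≡⟨ fromℤ-homo-+ (P ℤ.* Q) (C ℤ.* (T ℤ.* T)) ⟨
      fromℤ (P ℤ.* Q ℤ.+ C ℤ.* (T ℤ.* T))
        ≡⟨ cong fromℤ (M-catalan-multiples k n r n≥r) ⟩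
      fromℤ (S ℤ.* S)
        ≡⟨ fromℤ-homo-* S S ⟩
      fromℤ S * fromℤ S ∎)
  where
  open ≡-Reasoning
  P Q C T S : ℤ
  P = M (k ℕ.* (n ∸ r))
  Q = M (k ℕ.* (n ℕ.+ r))
  C = ((+ 2) ℤ.^ k) ℤ.^ (n ∸ r)
  T = M (k ℕ.* r)
  S = M (k ℕ.* n)
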